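{- Let $P$ be a (labelled disjunctive) program over the signature $\langle At, Lb\rangle$ and let $J$ be a standard (two-valued) interpretation. Then $J$ is a standard stable model of $P$ (i.e. $\mathrm{Atoms}(J)$ is a GL-stable model of $P$) if and only if there is some causal stable model $I$ of $P$ such that $I^{st}=J$ (i.e. $\mathrm{Atoms}(I)=\mathrm{Atoms}(J)$).
   Context: **Programs.** A signature is a pair $\langle At, Lb\rangle$ of a set of atoms and a set of labels, with $At \subseteq Lb$. A rule has the form $r_i:\ H_1 \vee \dots \vee H_l \vee \mathrm{not}\,H_{l+1}\vee\dots\vee \mathrm{not}\,H_k \leftarrow B_1,\dots,B_m,\mathrm{not}\,B_{m+1},\dots,\mathrm{not}\,B_n$ with $0\le l\le k$, $0\le m\le n$, label $r_i\in Lb$ and all $H_j,B_j\in At$. A fact $A$ stands for the rule $A: A\leftarrow$. Put $head^+=\{H_1,\dots,H_l\}$, $head^-=\{H_{l+1},\dots,H_k\}$, $body^+=\{B_1,\dots,B_m\}$, $body^-=\{B_{m+1},\dots,B_n\}$. A rule is positive if $head^-=body^-=\emptyset$. A program is a set of rules; it is positive if all its rules are positive. A set $S\subseteq At$ is closed under a program $P$ iff for every rule of $P$: if $body^+\cup head^-\subseteq S$ and $body^-\cap S=\emptyset$ then $head^+\cap S\neq\emptyset$. The reduct $P^S$ of $P$ w.r.t. $S\subseteq At$ is obtained by removing all rules with $body^-\cap S\ne\emptyset$, removing all rules with $head^-\not\subseteq S$, and removing all negative literals from the remaining rules. $S$ is a GL-stable model of $P$ iff $S$ is a $\subseteq$-minimal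 closed set under the positive program $P^S$. **Causal values.** Terms are built recursively: every label $l\in Lb$ is a term; $\prod S$ and $\sum S$ are terms for every (possibly empty, possibly infinite) set $S$ of terms; $t_1\cdot t_2$ is a term for terms $t_1,t_2$. Finite products and sums are written $t_1*\dots*t_n$ and $t_1+\dots+t_n$; $0$ is the empty sum and $1$ the empty product. Causal values are the equivalence classes of terms under the axioms of a completely distributive complete lattice with meet $*$ and join $+$, together with the following axioms, where $t,u,w$ are terms, $l$ is a label and $c,d,e$ are terms without addition: associativity $t\cdot(u\cdot w)=(t\cdot u)\cdot w$; absorption $t=t+u\cdot t\cdot w$ and $u\cdot t\cdot w=t*(u\cdot t\cdot w)$; identity $t=1\cdot t=t\cdot 1$; annihilator $0=t\cdot 0=0\cdot t$; idempotence $l\cdot l=l$; addition distributivity $t\cdot(u+w)=(t\cdot u)+(t\cdot w)$ and $(t+u)\cdot w=(t\cdot w)+(u\cdot w)$; product distributivity $c\cdot d\cdot e=(c\cdot d)*(d\cdot e)$ when $d\ne 1$, $c\cdot(d*e)=(c\cdot d)*(c\cdot e)$, $(c*d)\cdot e=(c\cdot e)*(d\cdot e)$; addition and product distributivity also hold over infinite sums and products. The lattice order is $t\le u$ iff $t*u=t$ iff $t+u=u$; $1$ is the top and $0$ the bottom. **Interpretations and models.** An interpretation is a map $I$ from $At$ to the set of causal values; it is standard (two-valued) if its values lie in $\{0,1\}$. $\mathrm{Atoms}(I)=\{A\in At: I(A)\ne 0\}$. $I^{st}$ is the standard interpretation with $I^{st}(A)=1$ if $I(A)>0$ and $I^{st}(A)=0$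 if $I(A)=0$. For a positive rule let $b=I(B_1)*\dots*I(B_m)$ (with $b=1$ for the empty body). $I$ satisfies the positive rule iff $b\cdot r_i\cdot H_j\le I(H_j)$ for some $H_j\in head^+$; if $head^+=\emptyset$, $I$ satisfies it iff $b=0$. $I$ is a model of a positive program iff it satisfies all its rules; a standard model is a model that is a standard interpretation. **Orders and stable models.** $I\le J$ iff $I(A)\le J(A)$ for all $A\in At$. $I\sqsubseteq J$ iff $I\le J$ or $\mathrm{Atoms}(I)\subsetneq \mathrm{Atoms}(J)$; $I\sqsubset J$ iff $I\sqsubseteq J$ and $I\ne J$. $I$ is $\sqsubseteq$-minimal with some property iff $I$ has it and no $J\sqsubset I$ has it. A causal stable model of a positive program is a model that is $\sqsubseteq$-minimal among all its models; a standard stable model of a positive program is a standard model that is $\sqsubseteq$-minimal among its standard models. For an arbitrary program $P$ and an interpretation $I$, the reduct $P^I$ is obtained by removing all rules with $I(B)\ne 0$ for some $B\in body^-$, removing all rules with $I(B)=0$ for some $B\in head^-$, and removing all negative literals from the remaining rules. $I$ is a causal stable model of $P$ iff it is a causal stable model of the positive program $P^I$. A standard interpretation $J$ is a standard stable model of $P$ iff it is a standard stable model of $P^J$, equivalently $\mathrm{Atoms}(J)$ is a GL-stable model of $P$. -}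

module Defs where

open import Level using (Level; suc; Lift; lift)
open import Axiom.ExcludedMiddle using (ExcludedMiddle)
open import Data.Bool.Base using (Bool; true; false; if_then_else_)
open import Data.Empty.Polymorphic using (⊥; ⊥-elim)
open import Data.List.Base using (List; []; _∷_)
open import Data.List.Membership.Propositional using (_∈_)
open import Data.List.Relation.Unary.All using (All)
open import Data.List.Relation.Unary.Any using (Any)
open import Data.Product.Base using (∃; ∃-syntax; _×_; _,_; proj₁; proj₂)
open import Data.Sum.Base using (_⊎_)
open import Function.Bundles using (_↣_; _⇔_; mk⇔; Injection)
open import Relation.Binary.PropositionalEquality.Core using (_≡_)
open import Relation.Nullary.Decidable.Core using (does)
open import Relation.Nullary.Negation.Core using (¬_)
open import Relation.Unary using (Pred; _⊆_; _⊂_)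

private
  variable
    ℓ : Level

------------------------------------------------------------------------
-- Terms

infixl 7 _·_ _*_
infixl 6 _+_

-- A set of terms is given as a family indexed by a type, i.e. as the range
-- of that family.
data Term {ℓ} (Lb : Set ℓ) : Set (suc ℓ) where
  label : Lb → Term Lb
  ∏ ∑   : {I : Set ℓ} → (I → Term Lb) → Term Lb
  _·_   : Term Lb → Term Lb → Term Lb

𝟘 𝟙 : {Lb : Set ℓ} → Term Lb
𝟘 = ∑ {I = ⊥} ⊥-elim
𝟙 = ∏ {I = ⊥} ⊥-elim

pair : {Lb : Set ℓ} → Term Lb → Term Lb → Lift ℓ Bool → Term Lb
pair t u (lift b) = if b then t else u

_*_ _+_ : {Lb : Set ℓ} → Term Lb → Term Lb → Term Lb
t * u = ∏ (pair t u)
t + u = ∑ (pair t u)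

data AdditionFree {ℓ} {Lb : Set ℓ} : Term Lb → Set (suc ℓ) where
  label : ∀ l → AdditionFree (label l)
  ∏     : {I : Set ℓ} {f : I → Term Lb} →
          (∀ i → AdditionFree (f i)) → AdditionFree (∏ f)
  _·_   : ∀ {t u} → AdditionFree t → AdditionFree u → AdditionFree (t · u)

------------------------------------------------------------------------
-- Equality and order of causal values

infix 4 Le Eq _≤_ _≈_

-- The parameter N is the side condition "d ≠ 1" of the axiom
-- c·d·e = (c·d)*(d·e).  It cannot be written as the negation of the relation
-- being generated, so the relation is first generated for an arbitrary N.
--
-- The complete lattice structure is presented by the order, with ∏ and ∑ as
-- greatest lower and least upper bounds; see ≤⇔* and ≤⇔+ below for the
-- relation to the algebraic form.

data Le {ℓ} {Lb : Set ℓ} (N : Term Lb → Set (suc ℓ)) : Term Lb → Term Lb → Set (suc ℓ)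
data Eq {ℓ} {Lb : Set ℓ} (N : Term Lb → Set (suc ℓ)) : Term Lb → Term Lb → Set (suc ℓ)

syntax Le N t u = N ⊢ t ≤ u
syntax Eq N t u = N ⊢ t ≈ u

data Le {ℓ} {Lb} N where
  ≤-reflexive : ∀ {t u} → N ⊢ t ≈ u → N ⊢ t ≤ u
  ≤-trans     : ∀ {t u w} → N ⊢ t ≤ u → N ⊢ u ≤ w → N ⊢ t ≤ w
  ∏-lower     : {I : Set ℓ} (f : I → Term Lb) → ∀ i → N ⊢ ∏ f ≤ f i
  ∏-greatest  : {I : Set ℓ} (f : I → Term Lb) → ∀ {t} →
                (∀ i → N ⊢ t ≤ f i) → N ⊢ t ≤ ∏ f
  ∑-upper     : {I : Set ℓ} (f : I → Term Lb) → ∀ i → N ⊢ f i ≤ ∑ f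
  ∑-least     : {I : Set ℓ} (f : I → Term Lb) → ∀ {t} →
                (∀ i → N ⊢ f i ≤ t) → N ⊢ ∑ f ≤ t

data Eq {ℓ} {Lb} N where
  ≈-refl    : ∀ {t} → N ⊢ t ≈ t
  ≈-sym     : ∀ {t u} → N ⊢ t ≈ u → N ⊢ u ≈ t
  ≈-trans   : ∀ {t u w} → N ⊢ t ≈ u → N ⊢ u ≈ w → N ⊢ t ≈ w
  ≤-antisym : ∀ {t u} → N ⊢ t ≤ u → N ⊢ u ≤ t → N ⊢ t ≈ u
  ·-cong    : ∀ {t t′ u u′} → N ⊢ t ≈ t′ → N ⊢ u ≈ u′ → N ⊢ t · u ≈ t′ · u′

  completely-distributive :
    {I : Set ℓ} {K : I → Set ℓ} (f : ∀ i → K i → Term Lb) →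
    N ⊢ ∏ (λ i → ∑ (f i)) ≈ ∑ {I = ∀ i → K i} (λ k → ∏ (λ i → f i (k i)))

  ·-assoc      : ∀ t u w → N ⊢ t · (u · w) ≈ (t · u) · w
  absorption-+ : ∀ t u w → N ⊢ t ≈ t + u · t · w
  absorption-* : ∀ t u w → N ⊢ u · t · w ≈ t * (u · t · w)
  ·-identityˡ  : ∀ t → N ⊢ t ≈ 𝟙 · t
  ·-identityʳ  : ∀ t → N ⊢ t ≈ t · 𝟙
  ·-zeroʳ      : ∀ t → N ⊢ 𝟘 ≈ t · 𝟘
  ·-zeroˡ      : ∀ t → N ⊢ 𝟘 ≈ 𝟘 · t
  ·-idem       : ∀ l → N ⊢ label l · label l ≈ label l

  -- The binary laws are the instances I = Lift ℓ Bool.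
  ·-distribˡ-∑ : ∀ t {I : Set ℓ} (f : I → Term Lb) →
                 N ⊢ t · ∑ f ≈ ∑ (λ i → t · f i)
  ·-distribʳ-∑ : ∀ t {I : Set ℓ} (f : I → Term Lb) →
                 N ⊢ ∑ f · t ≈ ∑ (λ i → f i · t)

  ·-split : ∀ {c d e} → AdditionFree c → AdditionFree d → AdditionFree e →
            N d → N ⊢ c · d · e ≈ (c · d) * (d · e)

  -- The index type must be inhabited: for the empty product the law would
  -- read c · 1 = 1.
  ·-distribˡ-∏ : ∀ {c} {I : Set ℓ} {f : I → Term Lb} →
                 AdditionFree c → (∀ i → AdditionFree (f i)) → I →
                 N ⊢ c · ∏ f ≈ ∏ (λ i → c · f i)
  ·-distribʳ-∏ : ∀ {c} {I : Set ℓ} {f : I → Term Lb} →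
                 AdditionFree c → (∀ i → AdditionFree (f i)) → I →
                 N ⊢ ∏ f · c ≈ ∏ (λ i → f i · c)

-- "d ≠ 1" is stated through the equality generated by the remaining axioms.
-- By ≉𝟙⇔NotOne below it is the same as d ≠ 1 in the final equality.
NotOne : {Lb : Set ℓ} → Term Lb → Set (suc ℓ)
NotOne d = ¬ ((λ _ → ⊥) ⊢ d ≈ 𝟙)

-- Causal values are the elements of the setoid (Term Lb, _≈_).
_≈_ _≤_ : {Lb : Set ℓ} → Term Lb → Term Lb → Set (suc ℓ)
t ≈ u = NotOne ⊢ t ≈ u
t ≤ u = NotOne ⊢ t ≤ u

≤⇔* : {Lb : Set ℓ} {t u : Term Lb} → t ≤ u ⇔ t * u ≈ t
≤⇔* {t = t} {u} = mk⇔
  (λ t≤u → ≤-antisym (∏-lower _ (lift true))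
    (∏-greatest _ λ { (lift true) → ≤-reflexive ≈-refl ; (lift false) → t≤u }))
  (λ eq → ≤-trans (≤-reflexive (≈-sym eq)) (∏-lower (pair t u) (lift false)))

≤⇔+ : {Lb : Set ℓ} {t u : Term Lb} → t ≤ u ⇔ t + u ≈ u
≤⇔+ {t = t} {u} = mk⇔
  (λ t≤u → ≤-antisym
    (∑-least _ λ { (lift true) → t≤u ; (lift false) → ≤-reflexive ≈-refl })
    (∑-upper (pair t u) (lift false)))
  (λ eq → ≤-trans (∑-upper (pair t u) (lift true)) (≤-reflexive eq))

-- For addition-free d, whether d = 1 does not depend on the side condition N:
-- it holds exactly when d contains no label.  Hence NotOne is the only side
-- condition (on addition-free terms) that agrees with the negation of the
-- equality to 1 which it generates.

private
  -- The two-valued reading in which all labels are false.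
  ⟦_⟧ : {Lb : Set ℓ} → Term Lb → Set ℓ
  ⟦ label l ⟧       = ⊥
  ⟦ ∏ {I = I} f ⟧   = (i : I) → ⟦ f i ⟧
  ⟦ ∑ {I = I} f ⟧   = ∃[ i ] ⟦ f i ⟧
  ⟦ t · u ⟧         = ⟦ t ⟧ × ⟦ u ⟧

  module _ {ℓ} {Lb : Set ℓ} {N : Term Lb → Set (suc ℓ)} where

    sound-≤ : ∀ {t u} → N ⊢ t ≤ u → ⟦ t ⟧ → ⟦ u ⟧
    to   : ∀ {t u} → N ⊢ t ≈ u → ⟦ t ⟧ → ⟦ u ⟧
    from : ∀ {t u} → N ⊢ t ≈ u → ⟦ u ⟧ → ⟦ t ⟧

    sound-≤ (≤-reflexive p)    x       = to p x
    sound-≤ (≤-trans p q)      x       = sound-≤ q (sound-≤ p x)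
    sound-≤ (∏-lower f i)      x       = x i
    sound-≤ (∏-greatest f p)   x i     = sound-≤ (p i) x
    sound-≤ (∑-upper f i)      x       = i , x
    sound-≤ (∑-least f p)      (i , x) = sound-≤ (p i) x

    to ≈-refl          x = x
    to (≈-sym p)       x = from p x
    to (≈-trans p q)   x = to q (to p x)
    to (≤-antisym p q) x = sound-≤ p x
    to (·-cong p q) (x , y) = to p x , to q y
    to (completely-distributive f) x = (λ i → proj₁ (x i)) , λ i → proj₂ (x i)
    to (·-assoc t u w) (x , y , z) = (x , y) , z
    to (absorption-+ t u w) x = lift true , x
    to (absorption-* t u w) x@((_ , y) , _) = λ { (lift true) → y ; (lift false) → x }
    to (·-identityˡ t) x = (λ ()) , x
    to (·-identityʳ t) x = x , λ ()
    to (·-zeroʳ t) (() , _)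
    to (·-zeroˡ t) (() , _)
    to (·-idem l) (x , _) = x
    to (·-distribˡ-∑ t f) (x , i , y) = i , x , y
    to (·-distribʳ-∑ t f) ((i , y) , x) = i , y , x
    to (·-split _ _ _ _) ((x , y) , z) = λ { (lift true) → x , y ; (lift false) → y , z }
    to (·-distribˡ-∏ _ _ _) (x , y) i = x , y i
    to (·-distribʳ-∏ _ _ _) (y , x) i = y i , x

    from ≈-refl          x = x
    from (≈-sym p)       x = to p x
    from (≈-trans p q)   x = from p (from q x)
    from (≤-antisym p q) x = sound-≤ q x
    from (·-cong p q) (x , y) = from p x , from q y
    from (completely-distributive f) (k , x) i = k i , x i
    from (·-assoc t u w) ((x , y) , z) = x , y , z
    from (absorption-+ t u w) (lift true , x) = x
    from (absorption-+ t u w) (lift false , (_ , x) , _) = x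
    from (absorption-* t u w) x = x (lift false)
    from (·-identityˡ t) (_ , x) = x
    from (·-identityʳ t) (x , _) = x
    from (·-zeroʳ t) (_ , () , _)
    from (·-zeroˡ t) ((() , _) , _)
    from (·-idem l) x = x , x
    from (·-distribˡ-∑ t f) (i , x , y) = x , i , y
    from (·-distribʳ-∑ t f) (i , y , x) = (i , y) , x
    from (·-split _ _ _ _) x = x (lift true) , proj₂ (x (lift false))
    from (·-distribˡ-∏ _ _ i₀) x = proj₁ (x i₀) , λ i → proj₂ (x i)
    from (·-distribʳ-∏ _ _ i₀) x = (λ i → proj₁ (x i)) , proj₂ (x i₀)

    complete : ∀ {d} → AdditionFree d → ⟦ d ⟧ → N ⊢ d ≈ 𝟙
    complete (label l) ()
    complete (∏ p) x = ≤-antisym (∏-greatest _ λ ())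
      (∏-greatest _ λ i → ≤-reflexive (≈-sym (complete (p i) (x i))))
    complete (p · q) (x , y) =
      ≈-trans (·-cong (complete p x) (complete q y)) (≈-sym (·-identityˡ 𝟙))

≈𝟙-independent : {Lb : Set ℓ} (N N′ : Term Lb → Set (suc ℓ)) {d : Term Lb} →
                 AdditionFree d → N ⊢ d ≈ 𝟙 ⇔ N′ ⊢ d ≈ 𝟙
≈𝟙-independent N N′ p = mk⇔ (λ q → complete p (from q λ ()))
                            (λ q → complete p (from q λ ()))

≉𝟙⇔NotOne : {Lb : Set ℓ} {d : Term Lb} → AdditionFree d → (¬ (d ≈ 𝟙)) ⇔ NotOne d
≉𝟙⇔NotOne p = mk⇔ (λ ne q → ne (complete p (from q λ ())))
                  (λ ne q → ne (complete p (from q λ ())))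

------------------------------------------------------------------------
-- Programs and their models

record Signature ℓ : Set (suc ℓ) where
  field
    At Lb : Set ℓ
    -- The inclusion At ⊆ Lb.
    At↣Lb : At ↣ Lb

  -- An atom as a term.
  atom : At → Term Lb
  atom A = label (Injection.to At↣Lb A)

module Semantics {ℓ} (S : Signature ℓ) where

  open Signature S

  record Rule : Set ℓ where
    field
      name                    : Lb
      head⁺ head⁻ body⁺ body⁻ : List At

  open Rule public

  -- The level suc ℓ accommodates the reducts by interpretations.
  Program : Set (suc (suc ℓ))
  Program = Pred Rule (suc ℓ)

  AtomSet : Set (suc (suc ℓ))
  AtomSet = Pred At (suc ℓ)

  positivePart : Rule → Rule
  positivePart r = record r { head⁻ = [] ; body⁻ = [] }

  reduct : Program → AtomSet → Program
  reduct P X r′ = ∃[ r ] P r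
                       × All (λ B → ¬ X B) (body⁻ r)
                       × All X (head⁻ r)
                       × r′ ≡ positivePart r

  Closed : Program → AtomSet → Set (suc ℓ)
  Closed P X = ∀ r → P r →
    All X (body⁺ r) → All X (head⁻ r) → All (λ B → ¬ X B) (body⁻ r) →
    Any X (head⁺ r)

  GLStable : Program → AtomSet → Set (suc (suc ℓ))
  GLStable P X = Closed (reduct P X) X
               × (∀ Y → Closed (reduct P X) Y → Y ⊆ X → X ⊆ Y)

  Interpretation : Set (suc ℓ)
  Interpretation = At → Term Lb

  infix 4 _≈ᴵ_ _≤ᴵ_ _⊑_ _⊏_

  _≈ᴵ_ _≤ᴵ_ : Interpretation → Interpretation → Set (suc ℓ)
  I ≈ᴵ J = ∀ A → I A ≈ J A
  I ≤ᴵ J = ∀ A → I A ≤ J A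

  Standard : Interpretation → Set (suc ℓ)
  Standard I = ∀ A → I A ≈ 𝟘 ⊎ I A ≈ 𝟙

  Atoms : Interpretation → AtomSet
  Atoms I A = ¬ (I A ≈ 𝟘)

  -- I ↦ Iˢᵗ; excluded middle decides whether I A = 0.
  standardise : ExcludedMiddle (suc ℓ) → Interpretation → Interpretation
  standardise em I A = if does (em {P = I A ≈ 𝟘}) then 𝟘 else 𝟙

  bodyValue : Interpretation → Rule → Term Lb
  bodyValue I r = ∏ {I = ∃[ B ] B ∈ body⁺ r} (λ (B , _) → I B)

  -- Satisfaction of a positive rule; negative literals are ignored.
  Satisfies : Interpretation → Rule → Set (suc ℓ)
  Satisfies I r with head⁺ r
  ... | []         = bodyValue I r ≈ 𝟘
  ... | Hs@(_ ∷ _) = Any (λ H → bodyValue I r · label (name r) · atom H ≤ I H) Hs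

  -- Models of a positive program.
  Model : Program → Interpretation → Set (suc ℓ)
  Model P I = ∀ r → P r → Satisfies I r

  _⊑_ _⊏_ : Interpretation → Interpretation → Set (suc ℓ)
  I ⊑ J = I ≤ᴵ J ⊎ Atoms I ⊂ Atoms J
  I ⊏ J = I ⊑ J × ¬ (I ≈ᴵ J)

  Minimal : (Interpretation → Set (suc ℓ)) → Interpretation → Set (suc ℓ)
  Minimal Q I = Q I × (∀ J → Q J → ¬ (J ⊏ I))

  PositiveCausalStable : Program → Interpretation → Set (suc ℓ)
  PositiveCausalStable P = Minimal (Model P)

  PositiveStandardStable : Program → Interpretation → Set (suc ℓ)
  PositiveStandardStable P = Minimal (λ J → Standard J × Model P J)

  CausalStable : Program → Interpretation → Set (suc ℓ)
  CausalStable P I = PositiveCausalStable (reduct P (Atoms I)) I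

  StandardStable : Program → Interpretation → Set (suc ℓ)
  StandardStable P J = PositiveStandardStable (reduct P (Atoms J)) J

{-# OPTIONS --safe #-}

-- A term is 0 exactly when it is false in the two-valued reading in which every
-- label is true.  Hence Atoms turns models into closed sets, indicator
-- functions turn closed sets into standard models, and minimality transfers.
--
-- The only real construction is that of a causal stable model from a minimal
-- closed set X.  Every model with atoms X selects, for each rule applicable in
-- X, a head atom in X that it satisfies.  A selection σ is a definite program,
-- whose least model ⟪ σ ⟫ assigns to A the sum of the values of the derivation
-- trees of A; it lies below every model that selects σ and, by minimality of X,
-- its atoms are X.  The infimum of a chain of models is a model, because heads
-- are finite, and it lies above some ⟪ σ ⟫.  Zorn's lemma on the selections
-- therefore gives a minimal ⟪ σ ⟫.  Selections, unlike interpretations, form a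
-- type at the level ℓ of the index types of infima.

module Submission where

open import Level using (Level; suc; lift; lower)
open import Axiom.ExcludedMiddle using (ExcludedMiddle)
open import Axiom.Extensionality.Propositional
  using (Extensionality; lower-extensionality)
open import Data.Bool.Base using (Bool; true; false; T; if_then_else_)
open import Data.Empty.Polymorphic using (⊥)
open import Data.List.Base using (List; []; _∷_)
open import Data.List.Membership.Propositional using (_∈_; lose; find)
open import Data.List.Relation.Unary.All as All using (All; []; _∷_)
open import Data.List.Relation.Unary.Any as Any using (Any; here; there)
open import Data.Maybe.Base using (Maybe; just; nothing)
open import Data.Product.Base using (∃; ∃-syntax; _×_; _,_; proj₁; proj₂; swap; Σ-syntax)
open import Data.Sum.Base as Sum using (_⊎_; inj₁; inj₂; [_,_]′)
open import Data.Unit.Polymorphic using (⊤; tt)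
open import Function.Base using (_∘_; id; case_of_)
open import Function.Bundles using (_⇔_; mk⇔; Equivalence)
open import Relation.Binary.PropositionalEquality.Core
  using (_≡_; refl; sym; subst)
open import Relation.Nullary.Decidable.Core
  using (Dec; yes; no; does; True; toWitness; fromWitness; map′; isYes)
open import Relation.Nullary.Negation.Core using (¬_; contradiction)
open import Relation.Unary using (_⊆_; _≐_)
open import Defs

private
  variable
    a p ℓ : Level

-- Choice and classical reasoning.

choice : {A : Set a} {P : A → Set p} → Dec (∃ P) → Maybe A
choice (yes (x , _)) = just x
choice (no _)        = nothing

choice-sound : {A : Set a} {P : A → Set p} (d : Dec (∃ P)) {x : A} →
               choice d ≡ just x → P x
choice-sound (yes (_ , px)) refl = px

choice-total : {A : Set a} {P : A → Set p} (d : Dec (∃ P)) →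
               ∃ P → ∃[ x ] choice d ≡ just x
choice-total (yes (x , _)) _ = x , refl
choice-total (no ¬∃)       e = contradiction e ¬∃

module Classical (em : ExcludedMiddle (suc ℓ)) where

  decide : (P : Set ℓ) → Dec P
  decide P = map′ lower lift em

  byContradiction : {P : Set (suc ℓ)} → ¬ ¬ P → P
  byContradiction {P} ¬¬p = case em {P} of λ where
    (yes p) → p
    (no ¬p) → contradiction ¬p ¬¬p

  ¬∀⇒∃¬ : {A : Set ℓ} {P : A → Set (suc ℓ)} → ¬ (∀ x → P x) → ∃[ x ] ¬ P x
  ¬∀⇒∃¬ ¬∀ = byContradiction λ ¬∃ → ¬∀ λ x → byContradiction λ ¬p → ¬∃ (x , ¬p)

-- Zorn's lemma

module Zorn
  (em : ExcludedMiddle (suc ℓ)) (ext : Extensionality (suc ℓ) (suc ℓ))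
  {A : Set ℓ} (_≼_ : A → A → Set (suc ℓ))
  (≼-refl : ∀ {x} → x ≼ x)
  (≼-trans : ∀ {x y z} → x ≼ y → y ≼ z → x ≼ z)
  (lowerBound : {I : Set ℓ} (c : I → A) →
                (∀ i j → c i ≼ c j ⊎ c j ≼ c i) → ∃[ b ] (∀ i → b ≼ c i))
  where

  open Classical em

  -- Subsets are Boolean-valued to make their type small and extensional.
  Subset : Set ℓ
  Subset = A → Bool

  infix 4 _∋_ _⊑_

  _∋_ : Subset → A → Set
  C ∋ x = T (C x)

  _⊑_ : Subset → Subset → Set ℓ
  C ⊑ D = ∀ x → C ∋ x → D ∋ x

  ⁅_⁆ : (A → Set ℓ) → Subset
  ⁅ P ⁆ x = isYes (decide (P x))

  ⊑-antisym : ∀ {C D} → C ⊑ D → D ⊑ C → C ≡ D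
  ⊑-antisym {C} {D} C⊑D D⊑C =
    lower-extensionality (suc ℓ) (suc ℓ) ext λ x → T-injective (C⊑D x) (D⊑C x)
    where
    T-injective : ∀ {b c} → (T b → T c) → (T c → T b) → b ≡ c
    T-injective {true}  {true}  _ _ = refl
    T-injective {true}  {false} f _ = contradiction _ f
    T-injective {false} {true}  _ g = contradiction _ g
    T-injective {false} {false} _ _ = refl

  StrictLowerBound : Subset → A → Set (suc ℓ)
  StrictLowerBound C b = ∀ x → C ∋ x → b ≼ x × ¬ (x ≼ b)

  below : Subset → A
  below C = case em {∃ (StrictLowerBound C)} of λ where
    (yes (b , _)) → b
    -- Arbitrary default, supplied by the lower bound of the empty chain.
    (no _)        → proj₁ (lowerBound {I = ⊥} (λ ()) (λ ()))

  below-strict : ∀ C → ∃ (StrictLowerBound C) → StrictLowerBound C (below C)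
  below-strict C e with em {∃ (StrictLowerBound C)}
  ... | yes (_ , s) = s
  ... | no ¬e       = contradiction e ¬e

  next : Subset → Subset
  next C = ⁅ (λ x → C ∋ x ⊎ x ≡ below C) ⁆

  ⋃ : {I : Set ℓ} → (I → Subset) → Subset
  ⋃ F = ⁅ (λ x → ∃[ i ] F i ∋ x) ⁆

  -- The tower of the Bourbaki-Witt argument, in place of a transfinite iteration of `next`. Its
  -- members are nested, and without a minimal element of `A` each of them is a chain.
  data Tower : Subset → Set (suc ℓ) where
    next-tower : ∀ {C} → Tower C → Tower (next C)
    ⋃-tower    : {I : Set ℓ} {F : I → Subset} → (∀ i → Tower (F i)) → Tower (⋃ F)

  ⊑-next : ∀ {C} → C ⊑ next C
  ⊑-next x x∈C = fromWitness (inj₁ x∈C)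

  ⊑-⋃ : {I : Set ℓ} {F : I → Subset} → ∀ i → F i ⊑ ⋃ F
  ⊑-⋃ i x x∈Fi = fromWitness (i , x∈Fi)

  ⋃-⊑ : {I : Set ℓ} {F : I → Subset} {D : Subset} → (∀ i → F i ⊑ D) → ⋃ F ⊑ D
  ⋃-⊑ F⊑D x x∈⋃ = let i , x∈Fi = toWitness x∈⋃ in F⊑D i x x∈Fi

  -- The extreme points of that argument: one step of `next` does not lead out of `D` from a tower
  -- member strictly inside `D`.
  Extreme : Subset → Set (suc ℓ)
  Extreme D = ∀ {C} → Tower C → C ⊑ D → C ≡ D ⊎ next C ⊑ D

  -- Induction on `C`. A union lies inside `D` unless one of its members already contains `next D`.
  extreme⇒comparable : ∀ {C D} → Extreme D → Tower C → C ⊑ D ⊎ next D ⊑ C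
  extreme⇒comparable eD (next-tower {C} tC) = case extreme⇒comparable eD tC of λ where
    (inj₁ C⊑D) → case eD tC C⊑D of λ where
      (inj₁ refl) → inj₂ λ _ → id
      (inj₂ C⁺⊑D) → inj₁ C⁺⊑D
    (inj₂ D⁺⊑C) → inj₂ λ x → ⊑-next {C} x ∘ D⁺⊑C x
  extreme⇒comparable {D = D} eD (⋃-tower {F = F} tF) = case decide (∃[ i ] next D ⊑ F i) of λ where
    (yes (i , D⁺⊑Fi)) → inj₂ λ x → ⊑-⋃ {F = F} i x ∘ D⁺⊑Fi x
    (no none)         → inj₁ (⋃-⊑ {F = F} {D} λ i →
      [ id , (λ D⁺⊑Fi → contradiction (i , D⁺⊑Fi) none) ]′ (extreme⇒comparable eD (tF i)))

  -- Induction on `D`, comparing `C` with the predecessor of `D` or with a member of the union that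
  -- is not inside `C`. If there is no such member, the union equals `C`.
  tower⇒extreme : ∀ {D} → Tower D → Extreme D
  tower⇒extreme (next-tower {D} tD) tC C⊑D⁺ =
    case extreme⇒comparable (tower⇒extreme tD) tC of λ where
      (inj₁ C⊑D)  → case tower⇒extreme tD tC C⊑D of λ where
        (inj₁ refl) → inj₂ λ _ → id
        (inj₂ C⁺⊑D) → inj₂ λ x → ⊑-next {D} x ∘ C⁺⊑D x
      (inj₂ D⁺⊑C) → inj₁ (⊑-antisym C⊑D⁺ D⁺⊑C)
  tower⇒extreme (⋃-tower {F = F} tF) {C} tC C⊑⋃F = case decide (∃[ i ] ¬ (F i ⊑ C)) of λ where
    (yes (i , Fi⋢C)) → case extreme⇒comparable (tower⇒extreme (tF i)) tC of λ where
      (inj₁ C⊑Fi)   → case tower⇒extreme (tF i) tC C⊑Fi of λ where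
        (inj₁ refl)  → contradiction (λ _ → id) Fi⋢C
        (inj₂ C⁺⊑Fi) → inj₂ λ x → ⊑-⋃ {F = F} i x ∘ C⁺⊑Fi x
      (inj₂ Fi⁺⊑C) → contradiction (λ x → Fi⁺⊑C x ∘ ⊑-next {F i} x) Fi⋢C
    (no all) → inj₁ (⊑-antisym C⊑⋃F (⋃-⊑ {F = F} {C} λ i → case decide (F i ⊑ C) of λ where
      (yes Fi⊑C) → Fi⊑C
      (no Fi⋢C)  → contradiction (i , Fi⋢C) all))

  comparable : ∀ {C D} → Tower C → Tower D → C ⊑ D ⊎ D ⊑ C
  comparable {C} {D} tC tD =
    Sum.map₂ (λ D⁺⊑C x → D⁺⊑C x ∘ ⊑-next {D} x) (extreme⇒comparable (tower⇒extreme tD) tC)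

  Chain : Subset → Set (suc ℓ)
  Chain C = ∀ x y → C ∋ x → C ∋ y → x ≼ y ⊎ y ≼ x

  Minimal : Set (suc ℓ)
  Minimal = ∃[ m ] (∀ x → x ≼ m → m ≼ x)

  module _ (¬minimal : ¬ Minimal) where

    -- A lower bound `b` of the chain is not minimal, so some `d` lies strictly below `b` and hence
    -- strictly below the whole chain.
    chain⇒below-strict : ∀ C → Chain C → StrictLowerBound C (below C)
    chain⇒below-strict C chain = below-strict C
      (let
        b , b≼ = lowerBound {I = ∃ (C ∋_)} proj₁ λ (x , x∈) (y , y∈) → chain x y x∈ y∈
        d , ¬[d≼b⇒b≼d] = ¬∀⇒∃¬ {P = λ d → d ≼ b → b ≼ d} λ min → ¬minimal (b , min)
        d≼b = byContradiction λ d⋠b → ¬[d≼b⇒b≼d] λ d≼b → contradiction d≼b d⋠b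
      in d , λ x x∈ → ≼-trans d≼b (b≼ (x , x∈)) ,
                      λ x≼d → ¬[d≼b⇒b≼d] λ _ → ≼-trans (b≼ (x , x∈)) x≼d)

    tower⇒chain : ∀ {C} → Tower C → Chain C
    tower⇒chain (next-tower {C} tC) x y x∈ y∈ =
      let bound = chain⇒below-strict C (tower⇒chain tC)
      in case toWitness x∈ , toWitness y∈ of λ where
        (inj₁ x∈C  , inj₁ y∈C)  → tower⇒chain tC x y x∈C y∈C
        (inj₁ x∈C  , inj₂ refl) → inj₂ (proj₁ (bound x x∈C))
        (inj₂ refl , inj₁ y∈C)  → inj₁ (proj₁ (bound y y∈C))
        (inj₂ refl , inj₂ refl) → inj₁ ≼-refl
    tower⇒chain (⋃-tower {F = F} tF) x y x∈ y∈ =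
      let i , x∈Fi = toWitness x∈
          j , y∈Fj = toWitness y∈
      in case comparable (tF i) (tF j) of λ where
        (inj₁ Fi⊑Fj) → tower⇒chain (tF j) x y (Fi⊑Fj x x∈Fi) y∈Fj
        (inj₂ Fj⊑Fi) → tower⇒chain (tF i) x y x∈Fi (Fj⊑Fi y y∈Fj)

    -- `True` makes membership in `Tower`, a type at level `suc ℓ`, small, so that the whole tower
    -- can index a union.
    family : ∃[ C ] True (em {Tower C}) → Subset
    family = proj₁

    top : Subset
    top = ⋃ family

    top-tower : Tower top
    top-tower = ⋃-tower λ (_ , tC) → toWitness tC

    -- `next top` is again in the tower, so the union already contains the element that `next` adds.
    -- That element would be strictly below itself.
    below-top∈top : top ∋ below top
    below-top∈top = ⊑-⋃ {F = family} (next top , fromWitness (next-tower top-tower)) (below top)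
      (fromWitness (inj₂ refl))

    below-top⋠below-top : ¬ (below top ≼ below top)
    below-top⋠below-top =
      proj₂ (chain⇒below-strict top (tower⇒chain top-tower) (below top) below-top∈top)

  zorn : Minimal
  zorn = byContradiction λ ¬minimal → contradiction ≼-refl (below-top⋠below-top ¬minimal)

-- Causal values

module Values (em : ExcludedMiddle (suc ℓ)) {Lb : Set ℓ} where

  open Classical em

  ⟦_⟧ : Term Lb → Set ℓ
  ⟦ label l ⟧ = ⊤
  ⟦ ∏ f ⟧     = ∀ i → ⟦ f i ⟧
  ⟦ ∑ f ⟧     = ∃[ i ] ⟦ f i ⟧
  ⟦ t · u ⟧   = ⟦ t ⟧ × ⟦ u ⟧

  -- All laws hold with `∏` and `·` read as conjunction and `∑` as disjunction.
  sound-≤ : ∀ {t u} → t ≤ u → ⟦ t ⟧ → ⟦ u ⟧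
  sound-≈ : ∀ {t u} → t ≈ u → ⟦ t ⟧ ⇔ ⟦ u ⟧

  sound-≤ (≤-reflexive p)  x       = Equivalence.to (sound-≈ p) x
  sound-≤ (≤-trans p q)    x       = sound-≤ q (sound-≤ p x)
  sound-≤ (∏-lower f i)    x       = x i
  sound-≤ (∏-greatest f p) x i     = sound-≤ (p i) x
  sound-≤ (∑-upper f i)    x       = i , x
  sound-≤ (∑-least f p)    (i , x) = sound-≤ (p i) x

  sound-≈ ≈-refl          = mk⇔ id id
  sound-≈ (≈-sym p)       = mk⇔ (Equivalence.from (sound-≈ p)) (Equivalence.to (sound-≈ p))
  sound-≈ (≈-trans p q)   = mk⇔ (Equivalence.to (sound-≈ q) ∘ Equivalence.to (sound-≈ p))
                                (Equivalence.from (sound-≈ p) ∘ Equivalence.from (sound-≈ q))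
  sound-≈ (≤-antisym p q) = mk⇔ (sound-≤ p) (sound-≤ q)
  sound-≈ (·-cong p q)    = mk⇔
    (λ (x , y) → Equivalence.to (sound-≈ p) x , Equivalence.to (sound-≈ q) y)
    (λ (x , y) → Equivalence.from (sound-≈ p) x , Equivalence.from (sound-≈ q) y)
  sound-≈ (completely-distributive f) = mk⇔
    (λ x → (λ i → proj₁ (x i)) , λ i → proj₂ (x i))
    (λ (k , x) i → k i , x i)
  sound-≈ (·-assoc t u w) = mk⇔ (λ (x , y , z) → (x , y) , z) (λ ((x , y) , z) → x , y , z)
  sound-≈ (absorption-+ t u w) = mk⇔ (λ x → lift true , x) λ where
    (lift true , x)              → x
    (lift false , ((_ , x) , _)) → x
  sound-≈ (absorption-* t u w) = mk⇔
    (λ x → λ { (lift true) → proj₂ (proj₁ x) ; (lift false) → x })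
    (λ x → x (lift false))
  sound-≈ (·-identityˡ t) = mk⇔ (λ x → (λ ()) , x) proj₂
  sound-≈ (·-identityʳ t) = mk⇔ (λ x → x , λ ()) proj₁
  sound-≈ (·-zeroʳ t) = mk⇔ (λ { (() , _) }) proj₂
  sound-≈ (·-zeroˡ t) = mk⇔ (λ { (() , _) }) proj₁
  sound-≈ (·-idem l) = mk⇔ proj₁ (λ x → x , x)
  sound-≈ (·-distribˡ-∑ t f) = mk⇔ (λ (x , i , y) → i , x , y) (λ (i , x , y) → x , i , y)
  sound-≈ (·-distribʳ-∑ t f) = mk⇔ (λ ((i , y) , x) → i , y , x) (λ (i , y , x) → (i , y) , x)
  sound-≈ (·-split _ _ _ _) = mk⇔
    (λ ((x , y) , z) → λ { (lift true) → x , y ; (lift false) → y , z })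
    (λ x → x (lift true) , proj₂ (x (lift false)))
  sound-≈ (·-distribˡ-∏ _ _ i₀) = mk⇔ (λ (x , y) i → x , y i)
                                      (λ x → proj₁ (x i₀) , λ i → proj₂ (x i))
  sound-≈ (·-distribʳ-∏ _ _ i₀) = mk⇔ (λ (y , x) i → y i , x)
                                      (λ x → (λ i → proj₁ (x i)) , proj₂ (x i₀))

  ≤-refl : {t : Term Lb} → t ≤ t
  ≤-refl = ≤-reflexive ≈-refl

  𝟘-minimum : {t : Term Lb} → 𝟘 ≤ t
  𝟘-minimum = ∑-least _ λ ()

  𝟙-maximum : {t : Term Lb} → t ≤ 𝟙
  𝟙-maximum = ∏-greatest _ λ ()

  ≤𝟘⇒≈𝟘 : {t : Term Lb} → t ≤ 𝟘 → t ≈ 𝟘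
  ≤𝟘⇒≈𝟘 t≤𝟘 = ≤-antisym t≤𝟘 𝟘-minimum

  ≈𝟘⇒·≈𝟘 : {t u : Term Lb} → t ≈ 𝟘 → t · u ≈ 𝟘
  ≈𝟘⇒·≈𝟘 t≈𝟘 = ≈-trans (·-cong t≈𝟘 ≈-refl) (≈-sym (·-zeroˡ _))

  ∏-mono : {I : Set ℓ} {f g : I → Term Lb} → (∀ i → f i ≤ g i) → ∏ f ≤ ∏ g
  ∏-mono {f = f} f≤g = ∏-greatest _ λ i → ≤-trans (∏-lower f i) (f≤g i)

  -- `t ≤ u` means that `t + u` equals `u`, and by distributivity `t · w` is a summand of
  -- `(t + u) · w`.
  ·-monoˡ-≤ : {t u w : Term Lb} → t ≤ u → t · w ≤ u · w
  ·-monoˡ-≤ {t} {u} {w} t≤u = ≤-trans (∑-upper (λ b → pair t u b · w) (lift true))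
    (≤-reflexive (≈-trans (≈-sym (·-distribʳ-∑ w (pair t u)))
                          (·-cong (Equivalence.to ≤⇔+ t≤u) ≈-refl)))

  ⟦⟧⇒≉𝟘 : {t : Term Lb} → ⟦ t ⟧ → ¬ (t ≈ 𝟘)
  ⟦⟧⇒≉𝟘 x t≈𝟘 = case Equivalence.to (sound-≈ t≈𝟘) x of λ ()

  -- Induction on the term. By excluded middle a false product has a false factor, and a factor
  -- equal to `𝟘` makes the product `𝟘`.
  ¬⟦⟧⇒≈𝟘 : ∀ t → ¬ ⟦ t ⟧ → t ≈ 𝟘
  ¬⟦⟧⇒≈𝟘 (label l) ¬x = contradiction tt ¬x
  ¬⟦⟧⇒≈𝟘 (∏ f) ¬x = case decide (∃[ i ] ¬ ⟦ f i ⟧) of λ where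
    (yes (i , ¬y)) → ≤𝟘⇒≈𝟘 (≤-trans (∏-lower f i) (≤-reflexive (¬⟦⟧⇒≈𝟘 (f i) ¬y)))
    (no all)       → contradiction (λ i → lower (byContradiction λ ¬y → all (i , ¬y ∘ lift))) ¬x
  ¬⟦⟧⇒≈𝟘 (∑ f) ¬x = ≤𝟘⇒≈𝟘 (∑-least f λ i → ≤-reflexive (¬⟦⟧⇒≈𝟘 (f i) λ y → ¬x (i , y)))
  ¬⟦⟧⇒≈𝟘 (t · u) ¬x = case decide ⟦ t ⟧ of λ where
    (yes y) → ≈-trans (·-cong ≈-refl (¬⟦⟧⇒≈𝟘 u λ z → ¬x (y , z))) (≈-sym (·-zeroʳ t))
    (no ¬y) → ≈𝟘⇒·≈𝟘 (¬⟦⟧⇒≈𝟘 t ¬y)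

  ≉𝟘⇒⟦⟧ : {t : Term Lb} → ¬ (t ≈ 𝟘) → ⟦ t ⟧
  ≉𝟘⇒⟦⟧ {t} t≉𝟘 = lower (byContradiction λ ¬x → t≉𝟘 (¬⟦⟧⇒≈𝟘 t (¬x ∘ lift)))

-- Models and closed sets

module Models (em : ExcludedMiddle (suc ℓ)) (S : Signature ℓ) where

  open Signature S
  open Semantics S
  open Classical em
  open Values em {Lb}

  -- `Closed` looks at negative literals while `Satisfies` ignores them, so closed sets are turned
  -- into models only for programs without such literals.
  Positive : Program → Set (suc ℓ)
  Positive Q = ∀ r → Q r → head⁻ r ≡ [] × body⁻ r ≡ []

  reduct-positive : ∀ P X → Positive (reduct P X)
  reduct-positive P X _ (_ , _ , _ , _ , refl) = refl , refl

  reduct-cong : ∀ {P X Y} → X ≐ Y → reduct P X ⊆ reduct P Y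
  reduct-cong (X⊆Y , Y⊆X) (r , r∈P , neg , pos , eq) =
    r , r∈P , All.map (λ ¬x y → ¬x (Y⊆X y)) neg , All.map X⊆Y pos , eq

  model-anti : ∀ {Q R I} → Q ⊆ R → Model R I → Model Q I
  model-anti Q⊆R m r r∈Q = m r (Q⊆R r∈Q)

  closed-anti : ∀ {Q R X} → Q ⊆ R → Closed R X → Closed Q X
  closed-anti Q⊆R c r r∈Q = c r (Q⊆R r∈Q)

  closed-cong : ∀ {Q X Y} → X ≐ Y → Closed Q X → Closed Q Y
  closed-cong (X⊆Y , Y⊆X) c r r∈Q body pos neg =
    Any.map X⊆Y (c r r∈Q (All.map Y⊆X body) (All.map Y⊆X pos) (All.map (λ ¬y x → ¬y (X⊆Y x)) neg))

  GLStable-cong : ∀ {P X Y} → X ≐ Y → GLStable P X → GLStable P Y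
  GLStable-cong {P} {X} {Y} X≐Y@(X⊆Y , Y⊆X) (c , min) =
    closed-anti {reduct P Y} {reduct P X} {Y} (reduct-cong {P} {Y} {X} (swap X≐Y))
      (closed-cong {reduct P X} X≐Y c) ,
    λ Z cZ Z⊆Y → min Z (closed-anti {reduct P X} {reduct P Y} {Z} (reduct-cong {P} {X} {Y} X≐Y) cZ)
      (X⊆Y′ Z⊆Y) ∘ Y⊆X
    where
    X⊆Y′ : ∀ {Z : AtomSet} → Z ⊆ Y → Z ⊆ X
    X⊆Y′ Z⊆Y z = Y⊆X (Z⊆Y z)

  -- Satisfaction of positive rules.

  SatisfiesHead : Interpretation → Rule → At → Set (suc ℓ)
  SatisfiesHead I r H = bodyValue I r · label (name r) · atom H ≤ I H

  -- Together with `Satisfies⇐` this trades the case distinction on an empty head for a disjunction: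
  -- with body value `𝟘`, the left side of every head inequality is `𝟘`.
  Satisfies⇒ : ∀ {I} r → Satisfies I r → bodyValue I r ≈ 𝟘 ⊎ Any (SatisfiesHead I r) (head⁺ r)
  Satisfies⇒ r sat with head⁺ r
  ... | []    = inj₁ sat
  ... | _ ∷ _ = inj₂ sat

  Satisfies⇐ : ∀ {I} r → bodyValue I r ≈ 𝟘 ⊎ Any (SatisfiesHead I r) (head⁺ r) → Satisfies I r
  Satisfies⇐ r sat with head⁺ r
  Satisfies⇐ r (inj₁ b≈𝟘) | []    = b≈𝟘
  Satisfies⇐ r (inj₁ b≈𝟘) | _ ∷ _ =
    here (≤-trans (≤-reflexive (≈𝟘⇒·≈𝟘 (≈𝟘⇒·≈𝟘 b≈𝟘))) 𝟘-minimum)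
  Satisfies⇐ r (inj₂ any) | _ ∷ _ = any

  bodyValue-mono : ∀ {I K} r → I ≤ᴵ K → bodyValue I r ≤ bodyValue K r
  bodyValue-mono r I≤K = ∏-mono λ (B , _) → I≤K B

  SatisfiesHead-mono : ∀ {I K r H t} → I ≤ᴵ K → SatisfiesHead K r H → K H ≤ t →
                       bodyValue I r · label (name r) · atom H ≤ t
  SatisfiesHead-mono {r = r} I≤K sat KH≤t =
    ≤-trans (·-monoˡ-≤ (·-monoˡ-≤ (bodyValue-mono r I≤K))) (≤-trans sat KH≤t)

  Atoms⇒bodyValue≉𝟘 : ∀ {I r} → All (Atoms I) (body⁺ r) → ¬ (bodyValue I r ≈ 𝟘)
  Atoms⇒bodyValue≉𝟘 body = ⟦⟧⇒≉𝟘 λ (_ , B∈) → ≉𝟘⇒⟦⟧ (All.lookup body B∈)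

  bodyValue≉𝟘⇒Atoms : ∀ {I r} → ¬ (bodyValue I r ≈ 𝟘) → All (Atoms I) (body⁺ r)
  bodyValue≉𝟘⇒Atoms b≉𝟘 = All.tabulate λ {B} B∈ IB≈𝟘 →
    b≉𝟘 (≤𝟘⇒≈𝟘 (≤-trans (∏-lower _ (B , B∈)) (≤-reflexive IB≈𝟘)))

  SatisfiesHead⇒Atoms : ∀ {I r H} → ¬ (bodyValue I r ≈ 𝟘) → SatisfiesHead I r H → Atoms I H
  SatisfiesHead⇒Atoms b≉𝟘 sat = ⟦⟧⇒≉𝟘 (sound-≤ sat ((≉𝟘⇒⟦⟧ b≉𝟘 , tt) , tt))

  satisfiedHead : ∀ {I r} → Satisfies I r → All (Atoms I) (body⁺ r) →
                  Any (SatisfiesHead I r) (head⁺ r)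
  satisfiedHead {r = r} sat body =
    [ (λ b≈𝟘 → contradiction b≈𝟘 (Atoms⇒bodyValue≉𝟘 {r = r} body)) , id ]′ (Satisfies⇒ r sat)

  model⇒closed : ∀ {Q I} → Model Q I → Closed Q (Atoms I)
  model⇒closed m r r∈Q body _ _ =
    Any.map (SatisfiesHead⇒Atoms {r = r} (Atoms⇒bodyValue≉𝟘 {r = r} body))
      (satisfiedHead {r = r} (m r r∈Q) body)

  closed⇒model : ∀ {Q J} → Positive Q → Standard J → Closed Q (Atoms J) → Model Q J
  closed⇒model {J = J} pos std closed r r∈Q = Satisfies⇐ r (case em {bodyValue J r ≈ 𝟘} of λ where
    (yes b≈𝟘) → inj₁ b≈𝟘
    (no b≉𝟘)  → let head⁻≡[] , body⁻≡[] = pos r r∈Q in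
      -- An atom of a standard interpretation has the top value, which bounds everything.
      inj₂ (Any.map (λ {H} JH≉𝟘 → ≤-trans 𝟙-maximum (≤-reflexive (≈-sym (≈𝟙 H JH≉𝟘))))
        (closed r r∈Q (bodyValue≉𝟘⇒Atoms {r = r} b≉𝟘)
          (subst (All _) (sym head⁻≡[]) []) (subst (All _) (sym body⁻≡[]) []))))
    where
    ≈𝟙 : ∀ H → Atoms J H → J H ≈ 𝟙
    ≈𝟙 H JH≉𝟘 = [ (λ JH≈𝟘 → contradiction JH≈𝟘 JH≉𝟘) , id ]′ (std H)

  Atoms-mono : ∀ {I K} → I ≤ᴵ K → Atoms I ⊆ Atoms K
  Atoms-mono I≤K {A} IA≉𝟘 KA≈𝟘 = IA≉𝟘 (≤𝟘⇒≈𝟘 (≤-trans (I≤K A) (≤-reflexive KA≈𝟘)))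

  Atoms-cong : ∀ {I K} → I ≈ᴵ K → Atoms I ≐ Atoms K
  Atoms-cong I≈K = Atoms-mono (λ A → ≤-reflexive (I≈K A)) ,
                   Atoms-mono (λ A → ≤-reflexive (≈-sym (I≈K A)))

  -- Standard interpretations and their atoms.

  standard-≤ : ∀ {I J} → Standard I → Standard J → Atoms I ⊆ Atoms J → I ≤ᴵ J
  standard-≤ stdI stdJ I⊆J A = case stdI A , stdJ A of λ where
    (inj₁ IA≈𝟘 , _)        → ≤-trans (≤-reflexive IA≈𝟘) 𝟘-minimum
    (inj₂ _    , inj₂ JA≈𝟙) → ≤-trans 𝟙-maximum (≤-reflexive (≈-sym JA≈𝟙))
    (inj₂ IA≈𝟙 , inj₁ JA≈𝟘) → contradiction JA≈𝟘
      (I⊆J (⟦⟧⇒≉𝟘 (Equivalence.from (sound-≈ IA≈𝟙) λ ())))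

  standard-≈ : ∀ {I J} → Standard I → Standard J → Atoms I ≐ Atoms J → I ≈ᴵ J
  standard-≈ stdI stdJ (I⊆J , J⊆I) A =
    ≤-antisym (standard-≤ stdI stdJ I⊆J A) (standard-≤ stdJ stdI J⊆I A)

  indicator : AtomSet → Interpretation
  indicator X A = if does (em {X A}) then 𝟙 else 𝟘

  indicator-standard : ∀ X → Standard (indicator X)
  indicator-standard X A with em {X A}
  ... | yes _ = inj₂ ≈-refl
  ... | no _  = inj₁ ≈-refl

  indicator-Atoms : ∀ X → Atoms (indicator X) ≐ X
  indicator-Atoms X = to , from
    where
    to : Atoms (indicator X) ⊆ X
    to {A} ≉𝟘 with em {X A}
    ... | yes x = x
    ... | no _  = contradiction ≈-refl ≉𝟘

    from : X ⊆ Atoms (indicator X)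
    from {A} x with em {X A}
    ... | yes _ = ⟦⟧⇒≉𝟘 λ ()
    ... | no ¬x = contradiction x ¬x

  standardise-standard : ∀ I → Standard (standardise em I)
  standardise-standard I A with em {I A ≈ 𝟘}
  ... | yes _ = inj₁ ≈-refl
  ... | no _  = inj₂ ≈-refl

  standardise-Atoms : ∀ I → Atoms (standardise em I) ≐ Atoms I
  standardise-Atoms I = to , from
    where
    to : Atoms (standardise em I) ⊆ Atoms I
    to {A} ≉𝟘 with em {I A ≈ 𝟘}
    ... | yes _   = contradiction ≈-refl ≉𝟘
    ... | no IA≉𝟘 = IA≉𝟘

    from : Atoms I ⊆ Atoms (standardise em I)
    from {A} IA≉𝟘 with em {I A ≈ 𝟘}
    ... | yes IA≈𝟘 = contradiction IA≈𝟘 IA≉𝟘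
    ... | no _     = ⟦⟧⇒≉𝟘 λ ()

  ≐-trans : {X Y Z : AtomSet} → X ≐ Y → Y ≐ Z → X ≐ Z
  ≐-trans (X⊆Y , Y⊆X) (Y⊆Z , Z⊆Y) = (λ x → Y⊆Z (X⊆Y x)) , λ z → Y⊆X (Z⊆Y z)

  standardise≈⇔Atoms≐ : ∀ {I J} → Standard J → standardise em I ≈ᴵ J ⇔ Atoms I ≐ Atoms J
  standardise≈⇔Atoms≐ {I} {J} std = mk⇔
    (λ eq → ≐-trans (swap (standardise-Atoms I)) (Atoms-cong eq))
    (λ eq → standard-≈ (standardise-standard I) std (≐-trans (standardise-Atoms I) eq))

  -- Covers causal and standard stable models at once: minimality is only
  -- needed against the standard models.
  minimal⇒GLStable : ∀ {P I} → let Q = reduct P (Atoms I) in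
    Model Q I → (∀ K → Standard K → Model Q K → ¬ (K ⊏ I)) → GLStable P (Atoms I)
  minimal⇒GLStable {P} {I} m min = model⇒closed m , λ Y cY Y⊆I {A} IA≉𝟘 → byContradiction λ ¬YA →
    let K             = indicator Y
        K⊆Y , Y⊆K     = indicator-Atoms Y
        std           = indicator-standard Y
        K⊆I           = λ {B} KB≉𝟘 → Y⊆I {B} (K⊆Y KB≉𝟘)
        I⊈K           = λ (I⊆K : Atoms I ⊆ Atoms K) → ¬YA (K⊆Y (I⊆K IA≉𝟘))
        closed        = closed-cong {reduct P (Atoms I)} (Y⊆K , K⊆Y) cY
    in min K std (closed⇒model (reduct-positive P (Atoms I)) std closed)
         (inj₂ (K⊆I , I⊈K) , λ K≈I → I⊈K (proj₂ (Atoms-cong K≈I)))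

  CausalStable⇒GLStable : ∀ {P I} → CausalStable P I → GLStable P (Atoms I)
  CausalStable⇒GLStable (m , min) = minimal⇒GLStable m λ K _ → min K

  StandardStable⇔GLStable : ∀ {P J} → Standard J → StandardStable P J ⇔ GLStable P (Atoms J)
  StandardStable⇔GLStable {P} {J} std = mk⇔
    (λ ((_ , m) , min) → minimal⇒GLStable m λ K stdK mK → min K (stdK , mK))
    (λ (closed , min) → (std , closed⇒model (reduct-positive P (Atoms J)) std closed) , λ where
      K (_    , mK) (inj₂ (K⊆J , J⊈K) , _)   → J⊈K (min (Atoms K) (model⇒closed mK) K⊆J)
      K (stdK , mK) (inj₁ K≤J         , K≉J) → K≉J (standard-≈ stdK std
        (Atoms-mono K≤J , min (Atoms K) (model⇒closed mK) (Atoms-mono K≤J))))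

  -- Infima of chains of models.

  module _ {I : Set ℓ} (F : I → Interpretation)
           (chain : ∀ i j → F i ≤ᴵ F j ⊎ F j ≤ᴵ F i) where

    ⋀ : Interpretation
    ⋀ A = ∏ λ i → F i A

    ⋀-lower : ∀ i → ⋀ ≤ᴵ F i
    ⋀-lower i A = ∏-lower (λ j → F j A) i

    lesser : ∀ i j → ∃[ m ] F m ≤ᴵ F i × F m ≤ᴵ F j
    lesser i j = case chain i j of λ where
      (inj₁ Fi≤Fj) → i , (λ _ → ≤-refl) , Fi≤Fj
      (inj₂ Fj≤Fi) → j , Fj≤Fi , λ _ → ≤-refl

    -- A pigeonhole principle: if each list element fails below some member of
    -- the chain, then all of them fail below the least of these members.
    cofinal : {A : Set ℓ} {R : I → A → Set (suc ℓ)} (xs : List A) → ∀ i →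
              (∀ j → F j ≤ᴵ F i → Any (R j) xs) →
              Any (λ x → ∀ j → ∃[ k ] F k ≤ᴵ F j × R k x) xs
    cofinal [] i any = case any i (λ _ → ≤-refl) of λ ()
    cofinal {R = R} (x ∷ xs) i any = case em {∀ j → ∃[ k ] F k ≤ᴵ F j × R k x} of λ where
      (yes p) → here p
      (no ¬p) →
        let j , none = ¬∀⇒∃¬ ¬p
            m , Fm≤Fi , Fm≤Fj = lesser i j
        in there (cofinal xs m λ k Fk≤Fm → case any k (λ A → ≤-trans (Fk≤Fm A) (Fm≤Fi A)) of λ where
          (here r)    → contradiction (k , (λ A → ≤-trans (Fk≤Fm A) (Fm≤Fj A)) , r) none
          (there any) → any)

    -- Each `F i H` is bounded through some `F j` below `F i` that satisfies the head; passing from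
    -- `F j` to the infimum only lowers the body value.
    ⋀-satisfiesHead : ∀ {r H} → (∀ i → ∃[ j ] F j ≤ᴵ F i × SatisfiesHead (F j) r H) →
                      SatisfiesHead ⋀ r H
    ⋀-satisfiesHead {r} {H} sats = ∏-greatest _ λ i →
      let j , Fj≤Fi , sat = sats i
      in SatisfiesHead-mono {K = F j} {r} (⋀-lower j) sat (Fj≤Fi H)

    -- Either the body is `𝟘` in some member, hence in the infimum, or every member satisfies some
    -- head atom. Heads are finite, so one atom is then satisfied cofinally.
    ⋀-model : ∀ {Q} → I → (∀ i → Model Q (F i)) → Model Q ⋀
    ⋀-model i₀ m r r∈Q = Satisfies⇐ r (case em {∃[ i ] bodyValue (F i) r ≈ 𝟘} of λ where
      (yes (i , b≈𝟘)) → inj₁ (≤𝟘⇒≈𝟘 (≤-trans (bodyValue-mono r (⋀-lower i)) (≤-reflexive b≈𝟘)))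
      (no none)       → inj₂ (Any.map (⋀-satisfiesHead {r})
        (cofinal {R = λ i → SatisfiesHead (F i) r} (head⁺ r) i₀ λ i _ →
          [ (λ b≈𝟘 → contradiction (i , b≈𝟘) none) , id ]′ (Satisfies⇒ r (m i r r∈Q)))))

  -- Derivation trees and least models of selections.

  -- A rule with `σ r ≡ nothing` is dropped. Subtrees are indexed like the factors of `bodyValue`,
  -- to fit complete distributivity.
  data Derivation (σ : Rule → Maybe At) : At → Set ℓ where
    node : ∀ r {A} → σ r ≡ just A → ((B : ∃[ B ] B ∈ body⁺ r) → Derivation σ (proj₁ B)) →
           Derivation σ A

  value : ∀ {σ A} → Derivation σ A → Term Lb
  value {A = A} (node r _ ds) = ∏ (λ B → value (ds B)) · label (name r) · atom A

  ⟪_⟫ : (Rule → Maybe At) → Interpretation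
  ⟪ σ ⟫ A = ∑ (value {σ} {A})

  -- Complete distributivity turns the body, a product of sums over trees, into a sum over choices
  -- of one tree per body atom. Each choice forms the subtrees of a `node` with root `r`.
  ⟪⟫-satisfiesHead : ∀ {σ r H} → σ r ≡ just H → SatisfiesHead ⟪ σ ⟫ r H
  ⟪⟫-satisfiesHead {σ} {r} {H} eq = ≤-trans
    (≤-reflexive (≈-trans (·-cong (≈-trans (·-cong (completely-distributive _) ≈-refl)
                                           (·-distribʳ-∑ _ _)) ≈-refl)
                          (·-distribʳ-∑ _ _)))
    (∑-least _ λ ds → ∑-upper value (node r eq ds))

  ⟪⟫-least : ∀ {σ K} → (∀ {r H} → σ r ≡ just H → SatisfiesHead K r H) → ⟪ σ ⟫ ≤ᴵ K
  ⟪⟫-least {σ} {K} sat A = ∑-least value value≤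
    where
    value≤ : ∀ {A} (d : Derivation σ A) → value d ≤ K A
    value≤ (node r eq ds) =
      ≤-trans (·-monoˡ-≤ (·-monoˡ-≤ (∏-mono λ B → value≤ (ds B)))) (sat eq)

  -- A causal stable model from a minimal closed set.

  module MinimalClosed
    (ext : Extensionality (suc ℓ) (suc ℓ))
    {Q : Program} (X : AtomSet)
    (X-closed : Closed Q X) (X-minimal : ∀ Y → Closed Q Y → Y ⊆ X → X ⊆ Y)
    (positive : Positive Q)
    where

    record Selects (σ : Rule → Maybe At) : Set (suc ℓ) where
      field
        sound : ∀ {r H} → σ r ≡ just H → H ∈ head⁺ r × X H
        total : ∀ r → Q r → All X (body⁺ r) → ∃[ H ] σ r ≡ just H

    open Selects

    -- `True` keeps the type at level `ℓ`, as Zorn's lemma requires.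
    Selection : Set ℓ
    Selection = ∃[ σ ] True (em {Selects σ})

    -- A nonzero sum has a true summand, that is, a derivation tree; its root rule has a selected
    -- head.
    ⟪⟫-Atoms : ∀ {σ} → Selects σ → Atoms ⟪ σ ⟫ ⊆ X
    ⟪⟫-Atoms sel ≉𝟘 = case ≉𝟘⇒⟦⟧ ≉𝟘 of λ where (node r eq _ , _) → proj₂ (sound sel eq)

    ⟪⟫-model : ∀ {σ} → Selects σ → Model Q ⟪ σ ⟫
    ⟪⟫-model {σ} sel r r∈Q = Satisfies⇐ r (case em {bodyValue ⟪ σ ⟫ r ≈ 𝟘} of λ where
      (yes b≈𝟘) → inj₁ b≈𝟘
      (no b≉𝟘)  →
        let H , eq = total sel r r∈Q (All.map (⟪⟫-Atoms sel) (bodyValue≉𝟘⇒Atoms {r = r} b≉𝟘))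
        in inj₂ (lose (proj₁ (sound sel eq)) (⟪⟫-satisfiesHead eq)))

    select : ∀ {K} → Model Q K → Atoms K ⊆ X → Σ[ (σ , _) ∈ Selection ] ⟪ σ ⟫ ≤ᴵ K
    select {K} m K⊆X = (σ , fromWitness selects) , ⟪⟫-least λ eq → proj₂ (proj₂ (choice-sound em eq))
      where
      Choice : Rule → At → Set (suc ℓ)
      Choice r H = H ∈ head⁺ r × X H × SatisfiesHead K r H

      σ : Rule → Maybe At
      σ r = choice (em {∃ (Choice r)})

      selects : Selects σ
      selects .sound eq = let H∈ , XH , _ = choice-sound em eq in H∈ , XH
      selects .total r r∈Q body =
        -- By minimality `K` has all atoms of `X`, so a rule applicable in `X` has nonzero body
        -- value in `K`.
        let body′        = All.map (X-minimal (Atoms K) (model⇒closed m) K⊆X) body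
            H , H∈ , sat = find (satisfiedHead {r = r} (m r r∈Q) body′)
            XH           = K⊆X (SatisfiesHead⇒Atoms {r = r} (Atoms⇒bodyValue≉𝟘 {r = r} body′) sat)
        in choice-total em (H , H∈ , XH , sat)

    infix 4 _≼_

    _≼_ : Selection → Selection → Set (suc ℓ)
    (σ , _) ≼ (τ , _) = ⟪ σ ⟫ ≤ᴵ ⟪ τ ⟫

    -- Lower bound of the empty chain, selected from the indicator of `X`.
    default : Selection
    default =
      let I⊆X , X⊆I = indicator-Atoms X
          model     = closed⇒model positive (indicator-standard X) (closed-cong {Q} (X⊆I , I⊆X) X-closed)
      in proj₁ (select model I⊆X)

    -- The infimum of the chain is a model with atoms in `X`; selecting from it leads back to
    -- selections.
    lowerBound : {I : Set ℓ} (c : I → Selection) →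
                 (∀ i j → c i ≼ c j ⊎ c j ≼ c i) → ∃[ b ] (∀ i → b ≼ c i)
    lowerBound {I} c chain = case decide I of λ where
      (yes i) →
        let F       = λ i → ⟪ proj₁ (c i) ⟫
            sel     = λ i → toWitness (proj₂ (c i))
            b , b≤⋀ = select (⋀-model F chain i λ i → ⟪⟫-model (sel i))
                           (λ ≉𝟘 → ⟪⟫-Atoms (sel i) (Atoms-mono (⋀-lower F chain i) ≉𝟘))
        in b , λ j A → ≤-trans (b≤⋀ A) (⋀-lower F chain j A)
      (no ¬i) → default , λ i → contradiction i ¬i

    minimalModel : ∃[ I ] PositiveCausalStable Q I × Atoms I ≐ X
    minimalModel =
      let (σ , w) , min = Zorn.zorn em ext _≼_ (λ _ → ≤-refl)
                            (λ p q A → ≤-trans (p A) (q A)) lowerBound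
          sel           = toWitness w
          model         = ⟪⟫-model sel
          I⊆X           = ⟪⟫-Atoms sel
          X⊆I           = X-minimal (Atoms ⟪ σ ⟫) (model⇒closed model) I⊆X
      in ⟪ σ ⟫ ,
         (model , λ where
           -- `K` lies above some `⟪ τ ⟫`, and minimality of `σ` closes the circle from `⟪ τ ⟫`
           -- through `K` and `⟪ σ ⟫`.
           K m (inj₁ K≤I , K≉I) →
             let τ , τ≤K = select m (λ ≉𝟘 → I⊆X (Atoms-mono K≤I ≉𝟘))
                 σ≤τ     = min τ λ A → ≤-trans (τ≤K A) (K≤I A)
             in K≉I λ A → ≤-antisym (K≤I A) (≤-trans (σ≤τ A) (τ≤K A))
           -- The atoms of `K` form a closed set inside `X`, hence all of `X`.
           K m (inj₂ (K⊆I , I⊈K) , _) →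
             I⊈K λ ≉𝟘 → X-minimal (Atoms K) (model⇒closed m) (λ ≉𝟘 → I⊆X (K⊆I ≉𝟘)) (I⊆X ≉𝟘)) ,
         (I⊆X , X⊆I)

  -- GL-stable sets and causal stable models.

  Minimal-cong : ∀ {Q R I} → Q ≐ R → PositiveCausalStable Q I → PositiveCausalStable R I
  Minimal-cong (Q⊆R , R⊆Q) (m , min) =
    model-anti R⊆Q m , λ K mK → min K (model-anti Q⊆R mK)

  -- The model is found for the reduct by `X`. A reduct depends only on the set of atoms, so the
  -- reduct by `Atoms I` has the same rules.
  GLStable⇒CausalStable : Extensionality (suc ℓ) (suc ℓ) → ∀ {P X} → GLStable P X →
                          ∃[ I ] CausalStable P I × Atoms I ≐ X
  GLStable⇒CausalStable ext {P} {X} (closed , min) =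
    let I , stable , I≐X = MinimalClosed.minimalModel ext X closed min (reduct-positive P X)
    in I , Minimal-cong (reduct-cong {P} (swap I≐X) , reduct-cong {P} I≐X) stable , I≐X

  GLStable⇔CausalStable : Extensionality (suc ℓ) (suc ℓ) → ∀ {P X} →
                          GLStable P X ⇔ (∃[ I ] CausalStable P I × Atoms I ≐ X)
  GLStable⇔CausalStable ext {P} = mk⇔ (GLStable⇒CausalStable ext {P})
    (λ (I , stable , I≐X) → GLStable-cong {P} I≐X (CausalStable⇒GLStable {P} stable))

theorem4 : ∀ {ℓ : Level} (em : ExcludedMiddle (suc ℓ)) → Extensionality (suc ℓ) (suc ℓ) →
    (S : Signature ℓ) → let open Semantics S in
    (P : Program) (J : Interpretation) → Standard J →
    (StandardStable P J ⇔ (∃[ I ] CausalStable P I × standardise em I ≈ᴵ J))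
    × (GLStable P (Atoms J) ⇔ (∃[ I ] CausalStable P I × Atoms I ≐ Atoms J))
theorem4 em ext S P J std =
  mk⇔ (λ stable → let I , causal , I≐J = Equivalence.to gl (Equivalence.to standard stable)
                  in I , causal , Equivalence.from (standardise≈⇔Atoms≐ std) I≐J)
      (λ (I , causal , I≈J) → Equivalence.from standard
        (Equivalence.from gl (I , causal , Equivalence.to (standardise≈⇔Atoms≐ std) I≈J))) ,
  gl
  where
  open Models em S
  standard = StandardStable⇔GLStable {P} std
  gl       = GLStable⇔CausalStable ext {P} {Semantics.Atoms S J}
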